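{- For every connected graph $G$ the following assertions are equivalent: (i) The end space of $G$ is second countable. (ii) The end space of $G$ is separable. (iii) There is a countable end-faithful normal tree $T\subseteq G$. (iv) The end space of $G$ has a countable base that consists of basic open sets.
   Context: Graphs may be infinite of any cardinality. Countable means finite or countably infinite. A ray is a one-way infinite path. Two rays in $G$ are equivalent if no finite set of vertices separates them; the equivalence classes are the ends of $G$, and $\Omega(G)$ is the set of ends. For finite $X\subseteq V(G)$ and $\omega\in\Omega(G)$, $C(X,\omega)$ is the unique component of $G-X$ that contains a tail of every ray in $\omega$. The end space of $G$ is $\Omega(G)$ with the topology having as a basis all sets $\Omega(X,C)=\{\omega\in\Omega(G): C(X,\omega)=C\}$, with $X\subseteq V(G)$ finite and $C$ a component of $G-X$; these sets $\Omega(X,C)$ are the basic open sets. Second countable means having a countable base; separable means having a countable dense subset. The tree-order of a rooted tree $(T,r)$ is given by $u\le v$ if $u$ lies on the path $rTv$ in $T$. A rooted tree $T\subseteq G$ is normal in $G$ if the endvertices of every $T$-path in $G$ are comparable in the tree-order of $T$, where a $T$-path in $G$ is a non-trivial path that meets $T$ exactly in its endvertices. A normal tree need not be spanning. For a subgraph $H\subseteq G$, rays equivalent in $H$ are equivalent in $G$, so there is a natural map $\iota:\Omega(H)\to\Omega(G)$ sending each end of $H$ to the end of $G$ that contains it as a subset; $H$ is end-faithful if $\iota$ is a bijection. -}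

module Defs where

open import Level using (suc; _⊔_)
open import Data.Empty using (⊥)
open import Data.List.Base using (List; []; _∷_; _++_; length; applyUpTo)
open import Data.List.Membership.Propositional using (_∈_; _∉_)
open import Data.List.Membership.Propositional.Properties
  using (∈-++⁺ˡ; ∈-++⁺ʳ; ∈-applyUpTo⁺)
open import Data.List.Relation.Unary.All using ([]; _∷_)
open import Data.List.Relation.Unary.All.Properties using (¬Any⇒All¬)
open import Data.List.Relation.Unary.Any using (here; there)
open import Data.List.Relation.Unary.Unique.Propositional using (Unique; []; _∷_)
open import Data.Nat.Base using (ℕ; zero; _+_; _<_) renaming (suc to 1+)
open import Data.Nat.Properties
  using (+-identityʳ; +-suc; +-assoc; +-comm; m≤m+n; <-irrefl; ≮⇒≥; _<?_; m≤n⇒∃[o]m+o≡n)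
open import Data.Product.Base using (Σ; Σ-syntax; ∃; ∃-syntax; ∃₂; _×_; _,_; proj₁; proj₂)
open import Data.Sum.Base using (_⊎_)
open import Function.Base using (_∘_)
open import Function.Bundles using (Func; Injection; _⇔_)
open import Function.Definitions using (Injective; Bijective)
open import Relation.Binary.Bundles using (Setoid)
open import Relation.Binary.Core using (Rel)
open import Relation.Binary.Definitions using (Symmetric; Reflexive; Transitive; Irreflexive)
open import Relation.Binary.Construct.Closure.ReflexiveTransitive as Star
  using (Star; ε; _◅_; _◅◅_)
import Relation.Binary.Construct.On as On
open import Relation.Binary.PropositionalEquality
  using (_≡_; refl; sym; trans; cong; subst; setoid)
open import Relation.Nullary using (¬_; yes; no; contradiction)
open import Relation.Nullary.Decidable using (¬¬-excluded-middle)
open import Relation.Unary using (Pred; _⊆_; _≐_)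
open import Relation.Unary.Relation.Binary.Equality using (≐-setoid)

-- A graph whose vertices form a subset of an ambient set V, so that a graph,
-- its subgraphs and its vertex-deleted subgraphs all have the same type.
record Graph {ℓ} (V : Set ℓ) : Set (suc ℓ) where
  field
    vertex      : Pred V ℓ
    edge        : Rel V ℓ
    symmetric   : Symmetric edge
    irreflexive : Irreflexive _≡_ edge
    endvertex   : ∀ {u v} → edge u v → vertex u

open Graph public

module _ {ℓ} {V : Set ℓ} where

  record _⊑_ (H G : Graph V) : Set ℓ where
    field
      vertex⊆ : vertex H ⊆ vertex G
      edge⊆   : ∀ {u v} → edge H u v → edge G u v

  open _⊑_ public

  -- Finite vertex sets are given by lists; entries of X outside G play no role.
  _−_ : Graph V → List V → Graph V
  vertex      (G − X) v             = vertex G v × v ∉ X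
  edge        (G − X) u v           = edge G u v × u ∉ X × v ∉ X
  symmetric   (G − X) (e , u∉ , v∉) = symmetric G e , v∉ , u∉
  irreflexive (G − X) u≡v (e , _)   = irreflexive G u≡v e
  endvertex   (G − X) (e , u∉ , _)  = endvertex G e , u∉

  vertices : ∀ {E : Rel V ℓ} {u v} → Star E u v → List V
  vertices {u = u} ε       = u ∷ []
  vertices {u = u} (_ ◅ w) = u ∷ vertices w

  -- The field source matters only for the trivial path.
  record Path (G : Graph V) (u v : V) : Set ℓ where
    field
      walk     : Star (edge G) u v
      distinct : Unique (vertices walk)
      source   : vertex G u

    verts : List V
    verts = vertices walk

  open Path public

  Connected : Graph V → Set ℓ
  Connected G = ∃ (vertex G) × (∀ {u v} → vertex G u → vertex G v → Path G u v)

  -- A cycle is a path with at least three vertices together with an edge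
  -- joining its last vertex to its first.
  Acyclic : Graph V → Set ℓ
  Acyclic G = ∀ {u v} (p : Path G u v) → 2 < length (verts p) → ¬ edge G v u

  IsTree : Graph V → Set ℓ
  IsTree T = Connected T × Acyclic T

  IsComponent : Graph V → Graph V → Set (suc ℓ)
  IsComponent G C =
    C ⊑ G × Connected C × (∀ D → D ⊑ G → Connected D → C ⊑ D → D ⊑ C)

  TreeOrder : Graph V → V → Rel V ℓ
  TreeOrder T r u v = Σ[ p ∈ Path T r v ] u ∈ verts p

  record TPath (T G : Graph V) (u v : V) : Set ℓ where
    field
      path       : Path G u v
      nontrivial : 1 < length (verts path)
      meetsAtEnds : ∀ {x} → x ∈ verts path → vertex T x ⇔ (x ≡ u ⊎ x ≡ v)

  record IsNormalTree (G T : Graph V) (r : V) : Set ℓ where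
    field
      subgraph   : T ⊑ G
      tree       : IsTree T
      root       : vertex T r
      comparable : ∀ {u v} → TPath T G u v → TreeOrder T r u v ⊎ TreeOrder T r v u

  record Ray (G : Graph V) : Set ℓ where
    field
      at        : ℕ → V
      injective : Injective _≡_ _≡_ at
      adjacent  : ∀ n → edge G (at n) (at (1+ n))

    on : Pred V ℓ
    on v = ∃[ n ] at n ≡ v

  open Ray public

  Separates : Graph V → List V → Pred V ℓ → Pred V ℓ → Set ℓ
  Separates G X A B = ∀ {u v} → A u → B v → ¬ Path (G − X) u v

  Equivalent : (G : Graph V) → Rel (Ray G) ℓ
  Equivalent G R S = ∀ X → ¬ Separates G X (on R) (on S)

  ray-⊑ : ∀ {H G} → H ⊑ G → Ray H → Ray G
  ray-⊑ H⊑G R = record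
    { at = at R ; injective = injective R ; adjacent = edge⊆ H⊑G ∘ adjacent R }

  private
    reverseWalk : ∀ (G : Graph V) {u v} → Star (edge G) u v → Star (edge G) v u
    reverseWalk G = Star.reverse (symmetric G)

    cut : ∀ {G : Graph V} {x u v} (w : Star (edge G) u v) → Unique (vertices w) →
          x ∈ vertices w → Σ[ w′ ∈ Star (edge G) x v ] Unique (vertices w′)
    cut ε       un       (here refl) = ε , un
    cut (e ◅ w) un       (here refl) = e ◅ w , un
    cut {G} (e ◅ w) (_ ∷ un) (there x∈) = cut {G} w un x∈

    erase : ∀ {G : Graph V} {u v} → Star (edge G) u v →
            ¬ ¬ (Σ[ w ∈ Star (edge G) u v ] Unique (vertices w))
    erase ε k = k (ε , [] ∷ [])
    erase {G} {u} (e ◅ w) k = erase {G} w λ where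
      (w′ , un) → ¬¬-excluded-middle {A = u ∈ vertices w′} λ where
        (yes u∈) → k (cut {G} w′ un u∈)
        (no  u∉) → k (e ◅ w′ , ¬Any⇒All¬ _ u∉ ∷ un)

    walk⇒path : ∀ {G : Graph V} {u v} → vertex G u → Star (edge G) u v → ¬ ¬ Path G u v
    walk⇒path {G} u∈G w k = erase {G} w λ where
      (w′ , un) → k (record { walk = w′ ; distinct = un ; source = u∈G })

    target : ∀ (G : Graph V) {u v} → vertex G u → Star (edge G) u v → vertex G v
    target G u∈G ε       = u∈G
    target G u∈G (e ◅ w) = target G (endvertex G (symmetric G e)) w

    Avoids : ∀ {G : Graph V} → Ray G → ℕ → List V → Set ℓ
    Avoids R n X = ∀ i → at R (n + i) ∉ X

    avoids : ∀ {G : Graph V} (R : Ray G) X → ¬ ¬ (∃[ n ] Avoids R n X)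
    avoids R []      k = k (0 , λ _ ())
    avoids R (x ∷ X) k = avoids R X λ (n , av) →
      ¬¬-excluded-middle {A = ∃[ j ] at R j ≡ x} λ where
        (no ∄j) → k (n , λ i → λ where
          (here eq)  → ∄j (n + i , eq)
          (there i∈) → av i i∈)
        (yes (j , refl)) → k (n + 1+ j , λ i → λ where
          (here eq)  → beyond n j i (injective R eq)
          (there i∈) → av (1+ j + i) (subst (λ m → at R m ∈ X) (+-assoc n (1+ j) i) i∈))
      where
      beyond : ∀ n j i → n + 1+ j + i ≡ j → ⊥
      beyond n j i eq = <-irrefl refl (subst (j <_) eq (subst (j <_)
        (sym (trans (cong (_+ i) (+-comm n (1+ j))) (+-assoc (1+ j) n i)))
        (m≤m+n (1+ j) (n + i))))

    along : ∀ {G : Graph V} (R : Ray G) {n X} → Avoids R n X →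
            ∀ i → Star (edge (G − X)) (at R n) (at R (n + i))
    along R {n} av zero rewrite +-identityʳ n = ε
    along {G} R {n} {X} av (1+ i) = along R av i ◅◅ (step ◅ ε)
      where
      step : edge (G − X) (at R (n + i)) (at R (n + 1+ i))
      step = subst (λ m → edge G (at R (n + i)) (at R m)) (sym (+-suc n i)) (adjacent R (n + i))
           , av i , av (1+ i)

    −-anti : ∀ (G : Graph V) X Y {u v} → Star (edge (G − (X ++ Y))) u v → Star (edge (G − X)) u v
    −-anti G X Y = Star.map λ (e , u∉ , v∉) → e , u∉ ∘ ∈-++⁺ˡ , v∉ ∘ ∈-++⁺ˡ

    late : ∀ {G : Graph V} (R : Ray G) X {n k} → at R k ∉ X ++ applyUpTo (at R) n →
           ∃[ i ] k ≡ n + i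
    late R X {n} {k} k∉ with k <? n
    ... | yes k<n = contradiction (∈-++⁺ʳ X (∈-applyUpTo⁺ (at R) k<n)) k∉
    ... | no  k≮n = let i , eq = m≤n⇒∃[o]m+o≡n (≮⇒≥ k≮n) in i , sym eq

  Equivalent-refl : ∀ (G : Graph V) → Reflexive (Equivalent G)
  Equivalent-refl G {R} X sep = avoids R X λ (n , av) →
    sep (n + 0 , refl) (n + 0 , refl) record
      { walk = ε ; distinct = [] ∷ [] ; source = endvertex G (adjacent R (n + 0)) , av 0 }

  Equivalent-sym : ∀ (G : Graph V) → Symmetric (Equivalent G)
  Equivalent-sym G R~S X sep = R~S X λ u∈R v∈S p →
    walk⇒path {G − X} (target (G − X) (source p) (walk p)) (reverseWalk (G − X) (walk p))
      (sep v∈S u∈R)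

  Equivalent-trans : ∀ (G : Graph V) → Transitive (Equivalent G)
  Equivalent-trans G {R} {S} {T} R~S S~T X sep = avoids S X λ (n , av) →
    let X′ = X ++ applyUpTo (at S) n in
    R~S X′ λ { {u} {_} u∈R (k , refl) p →
    S~T X′ λ { {_} {v} (l , refl) v∈T q →
      let (_ , k∉)   = target (G − X′) (source p) (walk p)
          (_ , l∉)   = source q
          (i , k≡)   = late S X k∉
          (j , l≡)   = late S X l∉
          (u∈G , u∉) = source p
          k⟶n = subst (λ m → Star (edge (G − X)) (at S m) (at S n)) (sym k≡)
                  (reverseWalk (G − X) (along S av i))
          n⟶l = subst (λ m → Star (edge (G − X)) (at S n) (at S m)) (sym l≡)
                  (along S av j)
      in walk⇒path {G − X} (u∈G , u∉ ∘ ∈-++⁺ˡ)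
           (−-anti G X _ (walk p) ◅◅ k⟶n ◅◅ n⟶l ◅◅ −-anti G X _ (walk q))
           (sep u∈R v∈T) } }

  Ends : Graph V → Setoid ℓ ℓ
  Ends G = record
    { Carrier = Ray G
    ; _≈_     = Equivalent G
    ; isEquivalence = record
      { refl  = λ {R} → Equivalent-refl G {R}
      ; sym   = λ {R} {S} → Equivalent-sym G {R} {S}
      ; trans = λ {R} {S} {T} → Equivalent-trans G {R} {S} {T}
      }
    }

  private
    −-mono : ∀ {H G : Graph V} → H ⊑ G → ∀ X → (H − X) ⊑ (G − X)
    −-mono H⊑G X = record
      { vertex⊆ = λ (v∈ , v∉) → vertex⊆ H⊑G v∈ , v∉
      ; edge⊆   = λ (e , uv∉) → edge⊆ H⊑G e , uv∉ }

    vertices-map : ∀ {E F : Rel V ℓ} (f : ∀ {u v} → E u v → F u v) {u v}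
                   (w : Star E u v) → vertices (Star.map {U = F} f w) ≡ vertices w
    vertices-map f ε       = refl
    vertices-map f (e ◅ w) = cong (_ ∷_) (vertices-map f w)

    path-⊑ : ∀ {H G : Graph V} → H ⊑ G → ∀ {u v} → Path H u v → Path G u v
    path-⊑ H⊑G p = record
      { walk     = Star.map (edge⊆ H⊑G) (walk p)
      ; distinct = subst Unique (sym (vertices-map (edge⊆ H⊑G) (walk p))) (distinct p)
      ; source   = vertex⊆ H⊑G (source p) }

  -- The natural map on ends, acting on representatives: the end of G that
  -- contains the H-end of R is the end of G represented by R.
  ι : ∀ {H G} → H ⊑ G → Func (Ends H) (Ends G)
  ι H⊑G = record
    { to   = ray-⊑ H⊑G
    ; cong = λ R~S X sep → R~S X λ u∈ v∈ p → sep u∈ v∈ (path-⊑ (−-mono H⊑G X) p) }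

  EndFaithful : ∀ {H G} → H ⊑ G → Set ℓ
  EndFaithful {H} {G} H⊑G = Bijective (Equivalent H) (Equivalent G) (Func.to (ι H⊑G))

  HasTailIn : ∀ {G} → Graph V → Pred (Ray G) ℓ
  HasTailIn C R = ∃[ n ] ∀ i → vertex C (at R (n + i))

  -- C(X,ω) is the unique component of G − X that contains a tail of every ray
  -- in ω, so for a component C of G − X this says that C(X,ω) = C, where ω is
  -- the end of R.
  Ω : (G : Graph V) → List V → Graph V → Pred (Ray G) ℓ
  Ω G X C R = ∀ S → Equivalent G S R → HasTailIn C S

  IsBasicOpen : (G : Graph V) → Pred (Pred (Ray G) ℓ) (suc ℓ)
  IsBasicOpen G U = ∃₂ λ X C → IsComponent (G − X) C × U ≐ Ω G X C

-- A subset P of a setoid, taken up to the equality of the setoid, is countable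
-- (finite or countably infinite).
Countable : ∀ {a r p} (S : Setoid a r) → Pred (Setoid.Carrier S) p → Set (a ⊔ r ⊔ p)
Countable S P = Injection (On.setoid S (proj₁ {B = P})) (setoid ℕ)

-- Sets of ends are given by predicates on rays.  Open sets respect equivalence
-- of rays because each Ω G X C does; the dense set below need not, and then
-- stands for the set of ends represented by its members.
module _ {ℓ} {V : Set ℓ} (G : Graph V) where

  IsOpen : Pred (Pred (Ray G) ℓ) (suc ℓ)
  IsOpen U = ∀ {R} → U R → ∃[ B ] IsBasicOpen G B × B R × B ⊆ U

  IsBase : Pred (Pred (Ray G) ℓ) (suc ℓ) → Set (suc ℓ)
  IsBase 𝓑 = 𝓑 ⊆ IsOpen
           × (∀ {U R} → IsOpen U → U R → ∃[ B ] 𝓑 B × B R × B ⊆ U)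

  IsDense : Pred (Ray G) ℓ → Set (suc ℓ)
  IsDense D = ∀ {U} → IsOpen U → ∃ U → ∃[ R ] D R × U R

  IsCountableBase : Pred (Pred (Ray G) ℓ) (suc ℓ) → Set (suc ℓ)
  IsCountableBase 𝓑 = Countable (≐-setoid (Ray G) ℓ) 𝓑 × IsBase 𝓑

  SecondCountable : Set (suc (suc ℓ))
  SecondCountable = ∃[ 𝓑 ] IsCountableBase 𝓑

  Separable : Set (suc ℓ)
  Separable = ∃[ D ] Countable (Ends G) D × IsDense D

  CountableEndFaithfulNormalTree : Set (suc ℓ)
  CountableEndFaithfulNormalTree =
    ∃₂ λ T r → Σ[ N ∈ IsNormalTree G T r ]
      Countable (setoid V) (vertex T) × EndFaithful (IsNormalTree.subgraph N)

  CountableBasicBase : Set (suc (suc ℓ))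
  CountableBasicBase = ∃[ 𝓑 ] IsCountableBase 𝓑 × 𝓑 ⊆ IsBasicOpen G

{-# OPTIONS --safe #-}
module Submission where

-- A normal tree T is tied to the ends of G by one fact: if Y is the down-closure of X ∩ T in T,
-- then tree vertices that are connected in G − Y are connected in T − X.
--
-- Hence inequivalent rays of T stay inequivalent in G.  If moreover every end of G has a ray in a
-- countable T, then the sets Ω(Y,C), with Y a finite set of vertices of T and C a component of
-- G − Y meeting T, form a countable base: when Ω(X,C′) contains an end ω, it also contains
-- Ω(Y,C(Y,ω)) for the above Y.
--
-- From a countable dense set of ends, a countable normal tree T containing a ray of each of them
-- is built as in Jung's theorem: a vertex outside the current finite tree is reached by a path
-- that starts in the highest neighbour of its component, and this path is added vertex by vertex.
-- By density no finite set separates T from a ray R of G, so one can climb T from the root, always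
-- towards R, and the resulting ray of T is equivalent to R.

open import Defs
open import Level using (suc; Lift; lift; lower)
open import Axiom.ExcludedMiddle using (ExcludedMiddle)
open import Data.Empty using (⊥)
open import Data.Fin.Base using (toℕ)
open import Data.Fin.Properties using () renaming (toℕ-injective to Fin-toℕ-injective)
open import Data.List.Base using (List; []; _∷_; _++_; length; map; applyUpTo; lookup; concatMap)
open import Data.List.Membership.Propositional using (_∈_; _∉_; lose; find)
open import Data.List.Membership.Propositional.Properties
  using (∈-++⁺ˡ; ∈-++⁺ʳ; ∈-applyUpTo⁺; ∈-concatMap⁺; ∈-concatMap⁻)
open import Data.List.Properties using (∷-injectiveˡ; ∷-injectiveʳ)
open import Data.List.Relation.Unary.All using ([]; _∷_)
open import Data.List.Relation.Unary.All.Properties using (¬Any⇒All¬; All¬⇒¬Any)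
open import Data.List.Relation.Unary.Any using (here; there; index)
open import Data.List.Relation.Unary.Any.Properties using (lookup-index)
open import Data.List.Relation.Unary.Unique.Propositional using (Unique; []; _∷_)
open import Data.Nat.Base using (ℕ; zero; _+_; _≤_; _<_; z≤n; s≤s; _⊔_) renaming (suc to 1+)
open import Data.Nat.Binary.Base as ℕᵇ using (ℕᵇ; 2[1+_]; 1+[2_])
open import Data.Nat.Binary.Properties using (toℕ-injective; 2[1+_]-injective; 1+[2_]-injective)
open import Data.Nat.Properties
  using (+-identityʳ; +-suc; +-assoc; +-comm; m≤m+n; m≤n⇒m≤o+n; m≤m⊔n; m≤n⊔m; ≤-antisym
        ; <-irrefl; ≮⇒≥; _<?_; m≤n⇒∃[o]m+o≡n; <-cmp)
open import Data.Product.Base using (Σ-syntax; ∃; ∃-syntax; ∃₂; _×_; _,_; proj₁; proj₂)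
open import Data.Sum.Base using (_⊎_; inj₁; inj₂; [_,_]′)
open import Function.Base using (_∘_; id)
open import Function.Bundles using (Injection; _⇔_; mk⇔; module Equivalence; module Func)
open import Relation.Binary.Bundles using (Setoid)
open import Relation.Binary.Core using (Rel)
open import Relation.Binary.Definitions using (Symmetric; tri<; tri≈; tri>)
open import Relation.Binary.Construct.Closure.ReflexiveTransitive as Star
  using (Star; ε; _◅_; _◅◅_)
open import Relation.Binary.PropositionalEquality
  using (_≡_; _≢_; refl; sym; trans; cong; cong₂; subst; setoid)
open import Relation.Nullary using (¬_; Dec; yes; no; contradiction)
open import Relation.Nullary.Decidable using (map′; decidable-stable)
open import Relation.Unary using (Pred; _⊆_; _≐_)
open import Relation.Unary.Relation.Binary.Equality using (≐-setoid)

-- Coding lists of numbers, and countability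

-- In bijective base 2 an entry n becomes n digits 2 followed by a digit 1.
encode : List ℕ → ℕᵇ
encode []             = ℕᵇ.zero
encode (zero ∷ ns)    = 1+[2 encode ns ]
encode (1+ n ∷ ns)    = 2[1+ encode (n ∷ ns) ]

encode-injective : ∀ ms ns → encode ms ≡ encode ns → ms ≡ ns
encode-injective []          []          _  = refl
encode-injective []          (zero ∷ _)  ()
encode-injective []          (1+ _ ∷ _)  ()
encode-injective (zero ∷ _)  []          ()
encode-injective (1+ _ ∷ _)  []          ()
encode-injective (zero ∷ _)  (1+ _ ∷ _)  ()
encode-injective (1+ _ ∷ _)  (zero ∷ _)  ()
encode-injective (zero ∷ ms) (zero ∷ ns) eq =
  cong (zero ∷_) (encode-injective ms ns (1+[2_]-injective eq))
encode-injective (1+ m ∷ ms) (1+ n ∷ ns) eq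
  with refl ← encode-injective (m ∷ ms) (n ∷ ns) (2[1+_]-injective eq) = refl

code : List ℕ → ℕ
code = ℕᵇ.toℕ ∘ encode

code-injective : ∀ {ms ns} → code ms ≡ code ns → ms ≡ ns
code-injective = encode-injective _ _ ∘ toℕ-injective

attach-proofs : ∀ {a p} {A : Set a} {P : Pred A p} (xs : List A) → (∀ {x} → x ∈ xs → P x) →
                Σ[ ys ∈ List (∃ P) ] map proj₁ ys ≡ xs
attach-proofs []       _   = [] , refl
attach-proofs (x ∷ xs) all with attach-proofs xs (all ∘ there)
... | ys , eq = (x , all (here refl)) ∷ ys , cong (x ∷_) eq

-- Meant for an `f` that numbers tree vertices paired with proofs: equal numbers identify only the
-- vertices, that is, the values of `proj₁`.
map-reflects : ∀ {a b c} {A : Set a} {B : Set b} {C : Set c} {f : A → B} {g : A → C} →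
               (∀ {x y} → f x ≡ f y → g x ≡ g y) →
               ∀ xs ys → map f xs ≡ map f ys → map g xs ≡ map g ys
map-reflects refl⇒ []       []       _  = refl
map-reflects refl⇒ (x ∷ xs) (y ∷ ys) eq =
  cong₂ _∷_ (refl⇒ (∷-injectiveˡ eq)) (map-reflects refl⇒ xs ys (∷-injectiveʳ eq))

least : ∀ {p} {P : Pred ℕ p} → (∀ n → Dec (P n)) → ∀ n → P n →
        ∃[ n ] P n × (∀ {m} → P m → n ≤ m)
least P? n pn with P? 0
least P? n      pn | yes p0 = 0 , p0 , λ _ → z≤n
least P? zero   pn | no ¬p0 = contradiction pn ¬p0
least P? (1+ n) pn | no ¬p0 with least (P? ∘ 1+) n pn
... | k , pk , min = 1+ k , pk , λ {m} → min′ m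
  where
  min′ : ∀ m → _ → 1+ k ≤ m
  min′ zero   p = contradiction p ¬p0
  min′ (1+ m) p = s≤s (min p)

-- An element may have several codes, but the least one depends only on its class under `_≈_`.
countable : ∀ {a r p c} (S : Setoid a r) → let open Setoid S in
            {P : Pred Carrier p} (Code : ℕ → Pred Carrier c) → (∀ n x → Dec (Code n x)) →
            (∀ {x} → P x → ∃[ n ] Code n x) →
            (∀ {n x y} → x ≈ y → Code n x → Code n y) →
            (∀ {n x y} → Code n x → Code n y → x ≈ y) →
            Countable S P
countable S {P} Code Code? coded resp unique = record
  { to        = proj₁ ∘ min
  ; cong      = λ {x} {y} x≈y → ≤-antisym
      (proj₂ (proj₂ (min x)) (resp (S.sym x≈y) (proj₁ (proj₂ (min y)))))
      (proj₂ (proj₂ (min y)) (resp x≈y (proj₁ (proj₂ (min x)))))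
  ; injective = λ {x} {y} eq → unique (proj₁ (proj₂ (min x)))
      (subst (λ n → Code n _) (sym eq) (proj₁ (proj₂ (min y))))
  }
  where
  module S = Setoid S
  min : (x : ∃ P) → ∃[ n ] Code n (proj₁ x) × (∀ {m} → Code m (proj₁ x) → n ≤ m)
  min (x , px) = let n , c = coded px in least (λ n → Code? n x) n c

-- Walks in graphs

module _ {ℓ} {V : Set ℓ} where

  module _ {E : Rel V ℓ} where

    head∈ : ∀ {u v} (w : Star E u v) → u ∈ vertices w
    head∈ ε       = here refl
    head∈ (_ ◅ _) = here refl

    last∈ : ∀ {u v} (w : Star E u v) → v ∈ vertices w
    last∈ ε       = here refl
    last∈ (_ ◅ w) = there (last∈ w)

    ∈-◅◅⁻ : ∀ {u v t x} (w : Star E u v) {w′ : Star E v t} →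
            x ∈ vertices (w ◅◅ w′) → x ∈ vertices w ⊎ x ∈ vertices w′
    ∈-◅◅⁻ ε       x∈         = inj₂ x∈
    ∈-◅◅⁻ (_ ◅ w) (here eq)  = inj₁ (here eq)
    ∈-◅◅⁻ (_ ◅ w) (there x∈) = [ inj₁ ∘ there , inj₂ ]′ (∈-◅◅⁻ w x∈)

    suffix : ∀ {u v x} (w : Star E u v) → x ∈ vertices w →
             Σ[ s ∈ Star E x v ] (∀ {y} → y ∈ vertices s → y ∈ vertices w)
               × (Unique (vertices w) → Unique (vertices s))
    suffix ε       (here refl) = ε , id , id
    suffix (e ◅ w) (here refl) = e ◅ w , id , id
    suffix (e ◅ w) (there x∈) with suffix w x∈
    ... | s , s⊆ , un = s , there ∘ s⊆ , λ { (_ ∷ unw) → un unw }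

    prefix : ∀ {u v x} (w : Star E u v) → x ∈ vertices w →
             Σ[ s ∈ Star E u x ] (∀ {y} → y ∈ vertices s → y ∈ vertices w)
    prefix ε       (here refl) = ε , id
    prefix (e ◅ w) (here refl) = ε , λ { (here eq) → here eq }
    prefix (e ◅ w) (there x∈) with prefix w x∈
    ... | s , s⊆ = e ◅ s , λ { (here eq) → here eq ; (there y∈) → there (s⊆ y∈) }

    strengthen : ∀ {F : Rel V ℓ} {u v} (w : Star E u v) →
      (∀ {x y} → x ∈ vertices w → y ∈ vertices w → E x y → F x y) → Star F u v
    strengthen ε       f = ε
    strengthen (e ◅ w) f =
      f (here refl) (there (head∈ w)) e ◅ strengthen w λ x∈ y∈ → f (there x∈) (there y∈)

    reverse : Symmetric E → ∀ {u v} (w : Star E u v) →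
              Σ[ w′ ∈ Star E v u ] (∀ {x} → x ∈ vertices w′ → x ∈ vertices w)
    reverse sy ε       = ε , id
    reverse sy (e ◅ w) with reverse sy w
    ... | w′ , ⊆w = w′ ◅◅ sy e ◅ ε , [ there ∘ ⊆w , last-edge ]′ ∘ ∈-◅◅⁻ w′
      where
      last-edge : ∀ {x} → x ∈ _ ∷ _ ∷ [] → x ∈ _ ∷ vertices w
      last-edge (here refl)         = there (head∈ w)
      last-edge (there (here refl)) = here refl

  vertices-map : ∀ {E F : Rel V ℓ} (f : ∀ {u v} → E u v → F u v) {u v}
                 (w : Star E u v) → vertices (Star.map {U = F} f w) ≡ vertices w
  vertices-map f ε       = refl
  vertices-map f (e ◅ w) = cong (_ ∷_) (vertices-map f w)

  module _ {G : Graph V} where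

    walk-in : ∀ {u v x} (w : Star (edge G) u v) → vertex G u → x ∈ vertices w → vertex G x
    walk-in ε       u∈ (here refl) = u∈
    walk-in (e ◅ w) u∈ (here refl) = u∈
    walk-in (e ◅ w) u∈ (there x∈)  = walk-in w (endvertex G (symmetric G e)) x∈

    rev : ∀ {u v} → Star (edge G) u v → Star (edge G) v u
    rev = proj₁ ∘ reverse (symmetric G)

    avoiding : ∀ {X u v} (w : Star (edge G) u v) → (∀ {x} → x ∈ vertices w → x ∉ X) →
               Star (edge (G − X)) u v
    avoiding w av = strengthen w λ x∈ y∈ e → e , av x∈ , av y∈

    stays-off : ∀ {X u v} → u ∉ X → Star (edge (G − X)) u v → v ∉ X
    stays-off u∉ ε                  = u∉
    stays-off u∉ ((_ , _ , v∉) ◅ w) = stays-off v∉ w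

    forget : ∀ {X u v} → Star (edge (G − X)) u v → Star (edge G) u v
    forget = Star.map proj₁

    clear-of : ∀ {X u v x} → u ∉ X → (w : Star (edge (G − X)) u v) →
               x ∈ vertices (forget w) → x ∉ X
    clear-of u∉ ε                  (here refl) = u∉
    clear-of u∉ (_ ◅ _)            (here refl) = u∉
    clear-of u∉ ((_ , _ , v∉) ◅ w) (there x∈)  = clear-of v∉ w x∈

    −-anti : ∀ {X Y} → (∀ {x} → x ∈ X → x ∈ Y) →
             ∀ {u v} → Star (edge (G − Y)) u v → Star (edge (G − X)) u v
    −-anti X⊆Y = Star.map λ (e , u∉ , v∉) → e , u∉ ∘ X⊆Y , v∉ ∘ X⊆Y

    along : (R : Ray G) → ∀ {n X} → (∀ i → at R (n + i) ∉ X) →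
            ∀ i → Star (edge (G − X)) (at R n) (at R (n + i))
    along R {n} {X} av zero rewrite +-identityʳ n = ε
    along R {n} {X} av (1+ i) = along R av i ◅◅ (step ◅ ε)
      where
      step : edge (G − X) (at R (n + i)) (at R (n + 1+ i))
      step = subst (λ m → edge G (at R (n + i)) (at R m)) (sym (+-suc n i)) (adjacent R (n + i))
           , av i , av (1+ i)

    walk-on : ∀ {H} → H ⊑ G → ∀ X {u v} → Star (edge (H − X)) u v → Star (edge (G − X)) u v
    walk-on H⊑G X = Star.map λ (e , uv∉) → edge⊆ H⊑G e , uv∉

  Avoids : ∀ {G : Graph V} → Ray G → ℕ → Pred (List V) ℓ
  Avoids R n X = ∀ i → at R (n + i) ∉ X

-- Rays, equivalence and components under excluded middle

module Classical {ℓ} (em : ExcludedMiddle (suc ℓ)) {V : Set ℓ} where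

  dec : (P : Set ℓ) → Dec P
  dec P = map′ lower lift (em {P = Lift (suc ℓ) P})

  stable : {P : Set ℓ} → ¬ ¬ P → P
  stable = decidable-stable (dec _)

  -- Loops are removed from the end of the walk: if the first vertex recurs on the shortened rest,
  -- only the part from the recurrence on is kept.
  erase : ∀ {E : Rel V ℓ} {u v} (w : Star E u v) →
          Σ[ w′ ∈ Star E u v ] Unique (vertices w′) × (∀ {x} → x ∈ vertices w′ → x ∈ vertices w)
  erase ε = ε , [] ∷ [] , id
  erase (_◅_ {i = u} e w) with erase w
  ... | w′ , un , ⊆w with dec (u ∈ vertices w′)
  ...   | yes u∈ = let s , s⊆ , un′ = suffix w′ u∈ in s , un′ un , there ∘ ⊆w ∘ s⊆
  ...   | no  u∉ = e ◅ w′ , ¬Any⇒All¬ _ u∉ ∷ un ,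
                   λ { (here eq) → here eq ; (there x∈) → there (⊆w x∈) }

  toPath : ∀ {G : Graph V} {u v} → vertex G u → Star (edge G) u v → Path G u v
  toPath u∈ w = let w′ , un , _ = erase w in
    record { walk = w′ ; distinct = un ; source = u∈ }

  avoids : ∀ {G : Graph V} (R : Ray G) X → ∃[ n ] Avoids R n X
  avoids R []      = 0 , λ _ ()
  avoids R (x ∷ X) with avoids R X | dec (∃[ j ] at R j ≡ x)
  ... | n , av | no ∄j = n , λ where
    i (here eq)  → ∄j (n + i , eq)
    i (there i∈) → av i i∈
  -- By injectivity `R` visits `x` only at `j`, so a start beyond both `n` and `j` works.
  ... | n , av | yes (j , refl) = n + 1+ j , λ where
      i (here eq)  → beyond i (injective R eq)
      i (there i∈) → av (1+ j + i) (subst (λ m → at R m ∈ X) (+-assoc n (1+ j) i) i∈)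
    where
    beyond : ∀ i → n + 1+ j + i ≢ j
    beyond i eq = <-irrefl (sym eq)
      (subst (j <_) (sym (+-assoc n (1+ j) i)) (m≤n⇒m≤o+n n (m≤m+n (1+ j) i)))

  module _ {G : Graph V} where

    late : ∀ (R : Ray G) {n k X} → Avoids R n X → at R k ∉ applyUpTo (at R) n →
           Star (edge (G − X)) (at R n) (at R k)
    late R {n} {k} av k∉ with k <? n
    ... | yes k<n = contradiction (∈-applyUpTo⁺ (at R) k<n) k∉
    ... | no  k≮n with m≤n⇒∃[o]m+o≡n (≮⇒≥ k≮n)
    ...   | i , refl = along R av i

    equivalent⁻ : ∀ {R S X n m} → Equivalent G R S → Avoids R n X → Avoids S m X →
                  Star (edge (G − X)) (at R n) (at S m)
    equivalent⁻ {R} {S} {X} {n} {m} R~S avR avS = stable λ ¬w →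
      -- Deleting the two initial segments as well forces the path to begin and end on the tails
      -- that avoid `X`.
      R~S (X ++ applyUpTo (at R) n ++ applyUpTo (at S) m) λ where
      (k , refl) (l , refl) p →
        let (_ , k∉) = source p
            l∉       = stays-off {G = G} k∉ (walk p)
        in ¬w (late R avR (k∉ ∘ ∈-++⁺ʳ X ∘ ∈-++⁺ˡ)
               ◅◅ −-anti {G = G} ∈-++⁺ˡ (walk p)
               ◅◅ rev {G = G − X} (late S avS (l∉ ∘ ∈-++⁺ʳ X ∘ ∈-++⁺ʳ (applyUpTo (at R) n))))

    equivalent⁺ : ∀ {R S} →
      (∀ X → ∃₂ λ n m → at R n ∉ X × Star (edge (G − X)) (at R n) (at S m)) → Equivalent G R S
    equivalent⁺ {R} meet X sep with meet X
    ... | n , m , n∉ , w =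
      sep (n , refl) (m , refl) (toPath {G = G − X} (endvertex G (adjacent R n) , n∉) w)

  component : Graph V → V → Graph V
  vertex      (component H v) w              = Star (edge H) v w
  edge        (component H v) a b            = edge H a b × Star (edge H) v a
  symmetric   (component H v) (e , w)        = symmetric H e , w ◅◅ e ◅ ε
  irreflexive (component H v) eq (e , _)     = irreflexive H eq e
  endvertex   (component H v) (_ , w)        = w

  component-walk : ∀ H {v a b} → Star (edge H) v a → Star (edge H) a b →
                   Star (edge (component H v)) a b
  component-walk H va ε       = ε
  component-walk H va (e ◅ w) = (e , va) ◅ component-walk H (va ◅◅ e ◅ ε) w

  module _ {H : Graph V} where

    component-isComponent : ∀ {v} → vertex H v → IsComponent H (component H v)
    component-isComponent {v} v∈ =
        record { vertex⊆ = λ w → walk-in {G = H} w v∈ (last∈ w) ; edge⊆ = proj₁ }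
      , ((v , ε) , λ va vb →
          toPath {component H v} va (component-walk H va (rev {G = H} va ◅◅ vb)))
      , λ D D⊑H (_ , conn) C⊑D →
          let reach = λ {d} (d∈ : vertex D d) →
                Star.map (edge⊆ D⊑H) (walk (conn (vertex⊆ C⊑D ε) d∈))
          in record { vertex⊆ = reach
                    ; edge⊆ = λ e → edge⊆ D⊑H e , reach (endvertex D e) }

    module _ {C : Graph V} (isC : IsComponent H C) where

      component-connected : ∀ {a b} → vertex C a → vertex C b → Star (edge H) a b
      component-connected a∈ b∈ =
        Star.map (edge⊆ (proj₁ isC)) (walk (proj₂ (proj₁ (proj₂ isC)) a∈ b∈))

      -- The set reachable from `a` is connected and includes `C`, so by maximality it is part of
      -- `C`.
      component-closed : ∀ {a b} → vertex C a → Star (edge H) a b → vertex C b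
      component-closed {a} a∈ w = vertex⊆ (proj₂ (proj₂ isC) (component H a)
        (proj₁ K) (proj₁ (proj₂ K)) C⊑K) w
        where
        K = component-isComponent (vertex⊆ (proj₁ isC) a∈)
        C⊑K : C ⊑ component H a
        C⊑K = record
          { vertex⊆ = component-connected a∈
          ; edge⊆   = λ e → edge⊆ (proj₁ isC) e , component-connected a∈ (endvertex C e) }

  module _ {G C : Graph V} {X : List V} where

    Ω-resp : ∀ {R S} → Equivalent G R S → Ω G X C R → Ω G X C S
    Ω-resp {R} {S} R~S R∈ Q Q~S =
      R∈ Q (Equivalent-trans G {Q} {S} {R} Q~S (Equivalent-sym G {R} {S} R~S))

    Ω-tail : ∀ {R} → Ω G X C R → HasTailIn C R
    Ω-tail {R} R∈ = R∈ R (Equivalent-refl G {R})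

    -- One ray decides for its whole end: an equivalent ray has a tail avoiding `X`, which is joined
    -- to the tail of `R` in `G − X` and so runs in `C`.
    Ω-intro : IsComponent (G − X) C → ∀ {R n} → Avoids R n X → vertex C (at R n) → Ω G X C R
    Ω-intro isC {R} {n} avR n∈ S S~R with avoids S X
    ... | m , avS = m , λ i → component-closed isC n∈
      (equivalent⁻ {R = R} {S} (Equivalent-sym G {S} {R} S~R) avR avS ◅◅ along S avS i)

  module _ {G : Graph V} where

    basic⇒open : ∀ {U} → IsBasicOpen G U → IsOpen G U
    basic⇒open {U} basic R∈U = U , basic , R∈U , id

    -- Components with a common vertex have the same vertices. This matters because base sets will
    -- be coded by a vertex of the component, not by the component itself.
    Ω-same : ∀ {X C D s} → IsComponent (G − X) C → IsComponent (G − X) D →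
             vertex C s → vertex D s → ∀ {R} → Ω G X C R → Ω G X D R
    Ω-same isC isD s∈C s∈D R∈ S S~R with R∈ S S~R
    ... | n , tail = n , λ i → component-closed isD s∈D (component-connected isC s∈C (tail i))

-- Normal trees and down-closures

module NormalTrees {ℓ} (em : ExcludedMiddle (suc ℓ)) {V : Set ℓ} where

  open Classical em {V}

  module _ {T : Graph V} (acyclic : Acyclic T) where

    -- If q missed u, the walk w followed by q reversed would avoid the edge au and close a cycle
    -- with it.
    bridge : ∀ {a u z} → edge T a u → (w : Star (edge T) u z) → a ∉ vertices w →
             (q : Star (edge T) a z) → u ∈ vertices q
    bridge {a} {u} au w a∉ q = stable λ u∉ →
      let q′ , ⊆q = reverse (symmetric T) q
          p , un , _ = erase {E = Detour}
            (strengthen w (λ _ y∈ e → e , λ { (_ , refl) → a∉ y∈ })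
             ◅◅ strengthen q′ (λ x∈ _ e → e , λ { (refl , _) → u∉ (⊆q x∈) }))
      in closes p un
      where
      -- Barring the step from `u` to `a` excludes the one-edge path; every longer path closes a
      -- cycle with the edge `au`.
      Detour : Rel V ℓ
      Detour x y = edge T x y × ¬ (x ≡ u × y ≡ a)

      2< : ∀ {x y} (w : Star (edge T) x y) → 2 < 2 + length (vertices w)
      2< ε       = s≤s (s≤s (s≤s z≤n))
      2< (_ ◅ _) = s≤s (s≤s (s≤s z≤n))

      closes : (p : Star Detour u a) → ¬ Unique (vertices p)
      closes ε un              = irreflexive T refl au
      closes ((_ , direct) ◅ ε) un = direct (refl , refl)
      closes (e ◅ f ◅ p) un    = acyclic
        (record { walk     = Star.map proj₁ (e ◅ f ◅ p)
                ; distinct = subst Unique (sym (vertices-map proj₁ (e ◅ f ◅ p))) un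
                ; source   = endvertex T (proj₁ e) })
        (2< (Star.map proj₁ p)) au

    -- Prepending the first edge of `p` to `q` reduces the claim to the next vertex of `p`. Only if
    -- that vertex is `u` may the prepended edge account for `u`, and then `bridge` finds `u` on
    -- `q`.
    upper-part : ∀ {a u v} (p : Star (edge T) a v) → Unique (vertices p) → u ∈ vertices p →
      Σ[ s ∈ Star (edge T) u v ] (∀ {z} → z ∈ vertices s → z ∈ vertices p)
        × (∀ {z} → z ∈ vertices s → (q : Star (edge T) a z) → u ∈ vertices q)
    upper-part ε       un (here refl) = ε , id , λ _ → head∈
    upper-part (e ◅ p) un (here refl) = e ◅ p , id , λ _ → head∈
    upper-part {a} {u} (e ◅ p) (a∉ ∷ un) (there u∈) with upper-part p un u∈
    ... | s , s⊆ , below = s , there ∘ s⊆ , below′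
      where
      below′ : ∀ {z} → z ∈ vertices s → (q : Star (edge T) a z) → u ∈ vertices q
      below′ z∈ q with below z∈ (symmetric T e ◅ q)
      ... | there u∈q = u∈q
      ... | here refl =
        let w , w⊆ = prefix p (s⊆ z∈) in bridge e w (All¬⇒¬Any a∉ ∘ w⊆) q

  module Normal {G T : Graph V} {r : V} (N : IsNormalTree G T r) where

    open IsNormalTree N

    rootPath : ∀ {x} → vertex T x → Path T r x
    rootPath = proj₂ (proj₁ tree) root

    below : ∀ {x} → Dec (vertex T x) → List V
    below (yes x∈) = verts (rootPath x∈)
    below (no  _)  = []

    -- The down-closure of X ∩ T in the tree-order; vertices of X outside T contribute nothing.
    closure : List V → List V
    closure = concatMap (λ x → below (dec (vertex T x)))

    closure⊆T : ∀ X {z} → z ∈ closure X → vertex T z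
    closure⊆T X z∈ with find (∈-concatMap⁻ _ {xs = X} z∈)
    ... | x , _ , z∈′ with dec (vertex T x)
    ...   | yes x∈ = walk-in {G = T} (walk (rootPath x∈)) root z∈′

    ∈-closure : ∀ {X x z} → x ∈ X → vertex T x →
                (∀ (q : Star (edge T) r x) → z ∈ vertices q) → z ∈ closure X
    ∈-closure {X} {x} {z} x∈X x∈T on-all = ∈-concatMap⁺ _ (lose x∈X z∈)
      where
      z∈ : z ∈ below (dec (vertex T x))
      z∈ with dec (vertex T x)
      ... | yes x∈ = on-all (walk (rootPath x∈))
      ... | no  x∉ = contradiction x∈T x∉

    ⊆-closure : ∀ {X x} → x ∈ X → vertex T x → x ∈ closure X
    ⊆-closure x∈X x∈T = ∈-closure x∈X x∈T last∈

    -- A vertex of `X` on the tree path from `u` up to `v` would lie above `u` and so put `u` into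
    -- `closure X`.
    upward : ∀ {X u v} → TreeOrder T r u v → u ∉ closure X → Star (edge (T − X)) u v
    upward {X} (p , u∈) u∉ with upper-part (proj₂ tree) (walk p) (distinct p) u∈
    ... | s , s⊆ , below-s = avoiding {G = T} s λ z∈s z∈X →
      u∉ (∈-closure z∈X (walk-in {G = T} (walk p) root (s⊆ z∈s)) (below-s z∈s))

    -- Shortened to a path, `w` is a `T`-path, so normality makes its ends comparable and `upward`
    -- joins them in the tree.
    bypass : ∀ {X x y} → vertex T x → vertex T y → x ∉ closure X → y ∉ closure X →
             (w : Star (edge G) x y) → (∀ {z} → z ∈ vertices w → vertex T z → z ≡ x ⊎ z ≡ y) →
             Star (edge (T − X)) x y
    bypass {X} {x} {y} x∈ y∈ x∉ y∉ w ends with dec (x ≡ y)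
    ... | yes refl = ε
    ... | no  x≢y  with comparable tpath
      where
      p = erase w
      1<length : ∀ {u v} (w : Star (edge G) u v) → u ≢ v → 1 < length (vertices w)
      1<length ε             u≢u = contradiction refl u≢u
      1<length (_ ◅ ε)       _   = s≤s (s≤s z≤n)
      1<length (_ ◅ (_ ◅ _)) _   = s≤s (s≤s z≤n)
      tpath : TPath T G x y
      tpath = record
        { path = record { walk = proj₁ p ; distinct = proj₁ (proj₂ p)
                        ; source = vertex⊆ subgraph x∈ }
        ; nontrivial  = 1<length (proj₁ p) x≢y
        ; meetsAtEnds = λ z∈ →
            mk⇔ (ends (proj₂ (proj₂ p) z∈)) λ { (inj₁ refl) → x∈ ; (inj₂ refl) → y∈ }
        }
    ...   | inj₁ x≤y = upward x≤y x∉
    ...   | inj₂ y≤x = rev {G = T − X} (upward y≤x y∉)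

    private
      -- The invariant for reading a walk from its end: `y` is the first tree vertex from `x` on,
      -- and beyond `y` the walk is already replaced by one in the tree.
      FirstHit : List V → V → V → Set ℓ
      FirstHit X x v = ∃[ y ] vertex T y × y ∉ closure X × Star (edge (T − X)) y v ×
        Σ[ w ∈ Star (edge G) x y ] (∀ {z} → z ∈ vertices w → vertex T z → z ≡ y)

      first-hit : ∀ {X x v} → vertex T v → x ∉ closure X →
                  Star (edge (G − closure X)) x v → FirstHit X x v
      first-hit v∈ v∉ ε = _ , v∈ , v∉ , ε , ε , λ { (here eq) _ → eq }
      first-hit {X} {x} v∈ x∉ ((e , _ , x′∉) ◅ w) with first-hit v∈ x′∉ w | dec (vertex T x)
      ... | y , y∈ , y∉ , yv , xy , off | no x∉T = y , y∈ , y∉ , yv , e ◅ xy , λ where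
        (here refl) z∈ → contradiction z∈ x∉T
        (there z∈w) z∈ → off z∈w z∈
      ... | y , y∈ , y∉ , yv , xy , off | yes x∈ =
        x , x∈ , x∉ , bypass x∈ y∈ x∉ y∉ (e ◅ xy) ends ◅◅ yv , ε , λ { (here eq) _ → eq }
        where
        ends : ∀ {z} → z ∈ x ∷ vertices xy → vertex T z → z ≡ x ⊎ z ≡ y
        ends (here eq)   _  = inj₁ eq
        ends (there z∈w) z∈ = inj₂ (off z∈w z∈)

    -- By normality consecutive tree vertices of a walk in G − closure X are comparable, and T joins
    -- them above closure X.
    inside : ∀ {X u v} → vertex T u → vertex T v → u ∉ closure X →
             Star (edge (G − closure X)) u v → Star (edge (T − X)) u v
    inside u∈ v∈ u∉ w with first-hit v∈ u∉ w
    ... | y , _ , _ , yv , uy , off with refl ← off (head∈ uy) u∈ = yv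

    on-tree : (S : Ray T) → ∀ n → vertex T (at S n)
    on-tree S n = endvertex T (adjacent S n)

    avoids-closure⇒avoids : (S : Ray T) → ∀ {n X} → Avoids S n (closure X) → Avoids S n X
    avoids-closure⇒avoids S av i i∈ = av i (⊆-closure i∈ (on-tree S _))

    -- For a finite set `X` deleted from `T`, equivalence in `G` is applied to `closure X`, and
    -- `inside` carries the resulting walk over to `T − X`.
    ι-injective : ∀ {R S : Ray T} → Equivalent G (ray-⊑ subgraph R) (ray-⊑ subgraph S) →
                  Equivalent T R S
    ι-injective {R} {S} R~S = equivalent⁺ {R = R} {S} λ X →
      let n , avR = avoids R (closure X)
          m , avS = avoids S (closure X)
          n∉ = avR 0
      in n + 0 , m + 0 , avoids-closure⇒avoids R avR 0 ,
         inside (on-tree R (n + 0)) (on-tree S (m + 0)) n∉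
           (rev {G = G − closure X} (along R′ avR 0)
            ◅◅ equivalent⁻ {R = R′} {S′} R~S avR avS ◅◅ along S′ avS 0)
      where
      R′ = ray-⊑ subgraph R
      S′ = ray-⊑ subgraph S

-- Trees given by parent relations

-- A rooted tree given by its parent relation: its vertices are those with a chain of parents
-- leading to r, and Star Parent v u says that u is below v in the tree-order.
record NormalParents {ℓ} {V : Set ℓ} (G : Graph V) (r : V) : Set (suc ℓ) where
  field
    Parent        : Rel V ℓ
    deterministic : ∀ {x p q} → Parent x p → Parent x q → p ≡ q
    rootless      : ∀ {p} → ¬ Parent r p
    parent-edge   : ∀ {x p} → Parent x p → edge G x p
    rooted        : ∀ {x p} → Parent x p → Star Parent p r
    normal        : ∀ {u v} → Star Parent u r → Star Parent v r → (w : Star (edge G) u v) →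
                    (∀ {z} → z ∈ vertices w → Star Parent z r → z ≡ u ⊎ z ≡ v) →
                    Star Parent u v ⊎ Star Parent v u

  _↑_ : Rel V ℓ
  _↑_ = Star Parent

  InTree : Pred V ℓ
  InTree v = v ↑ r

module ParentTrees {ℓ} (em : ExcludedMiddle (suc ℓ)) {V : Set ℓ}
                   {G : Graph V} {r : V} (r∈G : vertex G r) (P : NormalParents G r) where

  open Classical em {V}
  open NormalTrees em {V}
  open NormalParents P

  parentTree : Graph V
  vertex      parentTree         = InTree
  edge        parentTree u v     = Parent u v ⊎ Parent v u
  symmetric   parentTree         = λ { (inj₁ e) → inj₂ e ; (inj₂ e) → inj₁ e }
  irreflexive parentTree refl    = λ where
    (inj₁ e) → irreflexive G refl (parent-edge e)
    (inj₂ e) → irreflexive G refl (parent-edge e)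
  endvertex   parentTree         = λ { (inj₁ e) → e ◅ rooted e ; (inj₂ e) → rooted e }

  -- A cycle of parents through `u` also passes through the parent of `u`. Following the chain down
  -- to `r` it would reach the root, which has no parent.
  no-cycle : ∀ {u p} → InTree u → Parent u p → ¬ (p ↑ u)
  no-cycle ε        up _ = rootless up
  no-cycle (uq ◅ q) up pu with refl ← deterministic uq up with pu
  ... | ε       = no-cycle q up ε
  ... | pp′ ◅ w = no-cycle q pp′ (w ◅◅ up ◅ ε)

  last-step : ∀ {x u} → x ↑ u → x ≡ u ⊎ (∃[ t ] x ↑ t × Parent t u)
  last-step ε       = inj₁ refl
  last-step (e ◅ w) with last-step w
  ... | inj₁ refl         = inj₂ (_ , ε , e)
  ... | inj₂ (t , wt , f) = inj₂ (t , e ◅ wt , f)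

  -- A walk can leave the part of the tree above t only through the edge from t to its parent.
  stays-above : ∀ {t u x v} → Parent t u → (w : Star (edge parentTree) x v) → u ∉ vertices w →
                x ↑ t → v ↑ t
  stays-above tu ε            u∉ xt = xt
  stays-above tu (inj₂ f ◅ w) u∉ xt = stays-above tu w (u∉ ∘ there) (f ◅ xt)
  stays-above tu (inj₁ f ◅ w) u∉ ε with refl ← deterministic tu f =
    contradiction (there (head∈ w)) u∉
  stays-above tu (inj₁ f ◅ w) u∉ (g ◅ xt) with refl ← deterministic f g =
    stays-above tu w (u∉ ∘ there) xt

  stays-strictly-above : ∀ {u x v} → (w : Star (edge parentTree) x v) → u ∉ vertices w →
                         x ↑ u → v ↑ u
  stays-strictly-above w u∉ xu with last-step xu
  ... | inj₁ refl          = contradiction (head∈ w) u∉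
  ... | inj₂ (t , xt , tu) = stays-above tu w u∉ xt ◅◅ tu ◅ ε

  rev-∉ : ∀ {u v x} (w : Star (edge parentTree) u v) → x ∉ vertices w →
          Σ[ w′ ∈ Star (edge parentTree) v u ] x ∉ vertices w′
  rev-∉ w x∉ = let w′ , ⊆w = reverse (symmetric parentTree) w in w′ , x∉ ∘ ⊆w

  -- Read backwards, a walk missing `u` starts above `u` and cannot leave the part above `u`, which
  -- does not contain the root unless `u` is the root.
  below-all-walks : ∀ {u v} → v ↑ u → (w : Star (edge parentTree) r v) → u ∈ vertices w
  below-all-walks {u} vu w = stable λ u∉ → let w′ , u∉w′ = rev-∉ w u∉ in
    r-not-above u∉ (stays-strictly-above w′ u∉w′ vu)
    where
    r-not-above : u ∉ vertices w → ¬ (r ↑ u)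
    r-not-above u∉ ε       = u∉ (head∈ w)
    r-not-above u∉ (e ◅ _) = rootless e

  -- A path from u that closes up to a cycle either climbs from u to x, and then never returns below
  -- x, or descends from u to its parent x, and then cannot end in another child of u.
  acyclic : Acyclic parentTree
  acyclic p = no-closing-edge (source p) (walk p) (distinct p)
    where
    no-closing-edge : ∀ {u v} → InTree u → (w : Star (edge parentTree) u v) →
                      Unique (vertices w) → 2 < length (vertices w) → ¬ edge parentTree v u
    no-closing-edge u∈ ε       _ (s≤s ())
    no-closing-edge u∈ (_ ◅ ε) _ (s≤s (s≤s ()))
    no-closing-edge {u} {v} u∈ (_◅_ {j = x} e w@(_ ◅ w′)) (u∉ ∷ (x∉ ∷ _)) _ f = closing e f
      where
      u∉w : u ∉ vertices w
      u∉w = All¬⇒¬Any u∉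
      x≢v : x ≢ v
      x≢v refl = All¬⇒¬Any x∉ (last∈ w′)
      closing : edge parentTree u x → ¬ edge parentTree v u
      closing (inj₁ ux) (inj₁ vu) = let w⁻ , u∉w⁻ = rev-∉ w u∉w in
        no-cycle u∈ ux (stays-strictly-above w⁻ u∉w⁻ (vu ◅ ε))
      closing (inj₁ ux) (inj₂ uv) = x≢v (deterministic ux uv)
      closing (inj₂ xu) (inj₂ uv) = no-cycle u∈ uv (stays-strictly-above w u∉w (xu ◅ ε))
      closing (inj₂ xu) (inj₁ vu) with stays-above xu w u∉w ε
      ... | ε       = x≢v refl
      ... | vp ◅ px with refl ← deterministic vu vp = no-cycle (xu ◅ u∈) xu px

  parentTree⊑G : parentTree ⊑ G
  parentTree⊑G = record
    { vertex⊆ = λ { ε → r∈G ; (e ◅ _) → endvertex G (parent-edge e) }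
    ; edge⊆   = λ { (inj₁ e) → parent-edge e ; (inj₂ e) → symmetric G (parent-edge e) } }

  descent : ∀ {u v} → u ↑ v → Star (edge parentTree) u v
  descent = Star.map inj₁

  isNormalTree : IsNormalTree G parentTree r
  isNormalTree = record
    { subgraph   = parentTree⊑G
    ; tree       = ((r , ε) , path-between) , acyclic
    ; root       = ε
    ; comparable = comparable
    }
    where
    path-between : ∀ {u v} → InTree u → InTree v → Path parentTree u v
    path-between u∈ v∈ =
      toPath {G = parentTree} u∈ (descent u∈ ◅◅ rev {G = parentTree} (descent v∈))
    tree-order : ∀ {u v} → InTree v → v ↑ u → TreeOrder parentTree r u v
    tree-order v∈ vu = let p = path-between ε v∈ in p , below-all-walks vu (walk p)

    comparable : ∀ {u v} → TPath parentTree G u v →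
                 TreeOrder parentTree r u v ⊎ TreeOrder parentTree r v u
    comparable tp =
      [ inj₂ ∘ tree-order u∈ , inj₁ ∘ tree-order v∈ ]′
        (normal u∈ v∈ (walk path) (Equivalence.to ∘ meetsAtEnds))
      where
      open TPath tp
      u∈ = Equivalence.from (meetsAtEnds (head∈ (walk path))) (inj₁ refl)
      v∈ = Equivalence.from (meetsAtEnds (last∈ (walk path))) (inj₂ refl)

  -- Climbing the tree along a ray of the graph

  open Normal isNormalTree using (closure; ∈-closure; ⊆-closure; inside)

  -- This says that `s` lies in C(Z,ω), where ω is the end of `R`. Quantifying over a whole tail
  -- lets two such statements be compared at a common vertex of `R`.
  Near : Ray G → List V → Pred V ℓ
  Near R Z s = ∃[ n ] (∀ i → at R (n + i) ∉ Z × Star (edge (G − Z)) (at R (n + i)) s)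

  near-anti : ∀ {R Y Z} → (∀ {x} → x ∈ Y → x ∈ Z) → Near R Z ⊆ Near R Y
  near-anti Y⊆Z (n , near) = n , λ i → let a∉ , w = near i in a∉ ∘ Y⊆Z , −-anti {G = G} Y⊆Z w

  near-∉ : ∀ {R Z s} → Near R Z s → s ∉ Z
  near-∉ (n , near) = let a∉ , w = near 0 in stays-off {G = G} a∉ w

  near-walk : ∀ {R Z s t} → Near R Z s → Near R Z t → Star (edge (G − Z)) s t
  near-walk {R} {Z} {s} {t} (n , near-s) (m , near-t) =
    rev {G = G − Z} (proj₂ (near-s m))
    ◅◅ subst (λ k → Star (edge (G − Z)) (at R k) t) (+-comm m n) (proj₂ (near-t n))

  -- The ray climbs the tree from the root, at every step into the part of the tree that contains
  -- all tree vertices which a suitable finite set Z does not separate from R.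
  module Climb (R : Ray G) (meets : ∀ Z → ∃[ s ] InTree s × Near R Z s) where

    Node : Set ℓ
    Node = ∃[ t ] InTree t × ∃[ Z ] (∀ {s} → InTree s → Near R Z s → s ↑ t)

    next : ((t , _) : Node) → Σ[ (t′ , _) ∈ Node ] Parent t′ t
    -- Deleting also the down-closure of `t` keeps `s` strictly above `t`, hence above a child `t′`.
    -- Every other tree vertex near `R` is then joined to `s` by a tree walk missing `t`, so it lies
    -- above the same child.
    next (t , t∈ , Z , above) with meets (Z ++ closure (t ∷ []))
    ... | s , s∈ , near with last-step (above s∈ (near-anti {R} ∈-++⁺ˡ near))
    ...   | inj₁ refl =
      contradiction (∈-++⁺ʳ Z (⊆-closure {X = t ∷ []} (here refl) t∈)) (near-∉ {R} near)
    ...   | inj₂ (t′ , st′ , t′t) = (t′ , t′t ◅ t∈ , Z ++ closure (t ∷ []) , above′) , t′t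
      where
      above′ : ∀ {s′} → InTree s′ → Near R (Z ++ closure (t ∷ [])) s′ → s′ ↑ t′
      above′ s′∈ near′ = stays-above t′t (forget {G = parentTree} w) t∉ st′
        where
        w = inside {X = t ∷ []} s∈ s′∈ (near-∉ {R} near ∘ ∈-++⁺ʳ Z)
              (−-anti {G = G} (∈-++⁺ʳ Z) (near-walk {R} near near′))
        s∉ : s ∉ t ∷ []
        s∉ (here refl) = near-∉ {R} near (∈-++⁺ʳ Z (⊆-closure {X = t ∷ []} (here refl) t∈))
        t∉ : t ∉ vertices (forget {G = parentTree} w)
        t∉ = λ t∈w → clear-of {G = parentTree} s∉ w t∈w (here refl)

    nodes : ℕ → Node
    nodes zero   = r , ε , [] , λ s∈ _ → s∈
    nodes (1+ n) = proj₁ (next (nodes n))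

    private
      t : ℕ → V
      t n = proj₁ (nodes n)

      parent-t : ∀ n → Parent (t (1+ n)) (t n)
      parent-t n = proj₂ (next (nodes n))

      t↑t : ∀ n i → t (i + n) ↑ t n
      t↑t n zero   = ε
      t↑t n (1+ i) = parent-t (i + n) ◅ t↑t n i

      t-distinct : ∀ {m n} → m < n → t m ≢ t n
      t-distinct {m} m<n eq with m≤n⇒∃[o]m+o≡n m<n
      ... | i , refl = no-cycle (proj₁ (proj₂ (nodes (1+ m)))) (parent-t m)
        (subst (_↑ t (1+ m)) (trans (cong t (+-comm i (1+ m))) (sym eq)) (t↑t (1+ m) i))

      t-injective : ∀ {m n} → t m ≡ t n → m ≡ n
      t-injective {m} {n} eq with <-cmp m n
      ... | tri< m<n _ _ = contradiction eq (t-distinct m<n)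
      ... | tri≈ _ m≡n _ = m≡n
      ... | tri> _ _ n<m = contradiction (sym eq) (t-distinct n<m)

    climb : Ray parentTree
    at        climb         = t
    injective climb         = t-injective
    adjacent  climb n       = inj₂ (parent-t n)

    -- Once the climbing ray has left `closure X` at `t n`, no vertex of `X` lies above `t n`. A
    -- tree vertex `s` near `R` with respect to `X ++ Z` lies above `t n`, so the descent from `s`
    -- to `t n` avoids `X`, as does a walk from `R` to `s`.
    climb~R : Equivalent G (ray-⊑ parentTree⊑G climb) R
    climb~R = equivalent⁺ {R = ray-⊑ parentTree⊑G climb} {R} λ X →
      let n , av                = avoids climb (closure X)
          t∉                    = subst (λ k → t k ∉ closure X) (+-identityʳ n) (av 0)
          t∈ , Z , above        = proj₂ (nodes n)
          s , s∈ , near         = meets (X ++ Z)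
          s↑t                   = above s∈ (near-anti {R} (∈-++⁺ʳ X) near)
          clear                 = λ {z} (z↑t : z ↑ t n) (z∈X : z ∈ X) →
            t∉ (∈-closure {X = X} {z = t n} z∈X (z↑t ◅◅ t∈) (below-all-walks z↑t))
          m , near-s            = near
      in n , m + 0 , clear ε
       , rev {G = G − X}
           (−-anti {G = G} ∈-++⁺ˡ (proj₂ (near-s 0))
            ◅◅ walk-on parentTree⊑G X
                 (avoiding {G = parentTree} (descent s↑t) (clear ∘ on-descent s↑t)))
      where
      on-descent : ∀ {u v x} (w : u ↑ v) → x ∈ vertices (descent w) → x ↑ v
      on-descent ε       (here refl) = ε
      on-descent (e ◅ w) (here refl) = e ◅ w
      on-descent (e ◅ w) (there x∈)  = on-descent w x∈

-- Jung's construction of a countable normal tree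

module Jung {ℓ} (em : ExcludedMiddle (suc ℓ)) {V : Set ℓ} {G : Graph V}
            (connected : Connected G) {r : V} (r∈G : vertex G r) where

  open Classical em {V}
  open NormalParents

  trivial : NormalParents G r
  Parent        trivial _ _ = Lift ℓ ⊥
  deterministic trivial ()
  rootless      trivial ()
  parent-edge   trivial ()
  rooted        trivial ()
  normal        trivial ε ε _ _ = inj₁ ε

  -- A walk from z to x witnesses that z lies in the tree and has a neighbour in the component of x
  -- outside the tree.
  Attached : NormalParents G r → V → Pred V ℓ
  Attached P x z =
    InTree P z × Σ[ w ∈ Star (edge G) z x ] (∀ {y} → y ∈ vertices w → InTree P y → y ≡ z)

  -- The condition under which `x` can become a child of `t` without loss of normality.
  Dominates : NormalParents G r → V → Pred V ℓ
  Dominates P x t = ∀ {z} → Attached P x z → Star (Parent P) t z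

  module _ (P : NormalParents G r) {x t : V} (x∉ : ¬ InTree P x) (t∈ : InTree P t)
           (xt : edge G x t) (t-dominates : Dominates P x t) where

    private
      Parent′ : Rel V ℓ
      Parent′ y p = Parent P y p ⊎ (y ≡ x × p ≡ t)

      grow : ∀ {u v} → Star (Parent P) u v → Star Parent′ u v
      grow = Star.map inj₁

      old-or-new : ∀ {y} → Star Parent′ y r → InTree P y ⊎ y ≡ x
      old-or-new ε                    = inj₁ ε
      old-or-new (inj₁ e ◅ _)         = inj₁ (e ◅ rooted P e)
      old-or-new (inj₂ (y≡x , _) ◅ _) = inj₂ y≡x

      -- The walk attaches `u` to `x` with respect to the old tree, so `u` lies below `t` and hence
      -- below `x`.
      new-tree : ∀ {u} → InTree P u → (w : Star (edge G) u x) →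
                 (∀ {z} → z ∈ vertices w → Star Parent′ z r → z ≡ u ⊎ z ≡ x) → Star Parent′ x u
      new-tree u∈ w ends = inj₂ (refl , refl) ◅ grow (t-dominates (u∈ , w , λ y∈w y∈ →
        [ id , (λ { refl → contradiction y∈ x∉ }) ]′ (ends y∈w (grow y∈))))

    addVertex : NormalParents G r
    Parent addVertex = Parent′
    deterministic addVertex (inj₁ e)       (inj₁ f)          = deterministic P e f
    deterministic addVertex (inj₁ e)       (inj₂ (refl , _)) = contradiction (e ◅ rooted P e) x∉
    deterministic addVertex (inj₂ (refl , _)) (inj₁ f)       = contradiction (f ◅ rooted P f) x∉
    deterministic addVertex (inj₂ (_ , refl)) (inj₂ (_ , refl)) = refl
    rootless      addVertex (inj₁ e)          = rootless P e
    rootless      addVertex (inj₂ (refl , _)) = x∉ ε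
    parent-edge   addVertex (inj₁ e)             = parent-edge P e
    parent-edge   addVertex (inj₂ (refl , refl)) = xt
    rooted        addVertex (inj₁ e)          = grow (rooted P e)
    rooted        addVertex (inj₂ (_ , refl)) = grow t∈
    normal        addVertex u∈ v∈ w ends with old-or-new u∈ | old-or-new v∈
    ... | inj₁ u∈P  | inj₁ v∈P  =
      [ inj₁ ∘ grow , inj₂ ∘ grow ]′ (normal P u∈P v∈P w λ z∈w → ends z∈w ∘ grow)
    ... | inj₁ u∈P  | inj₂ refl = inj₂ (new-tree u∈P w ends)
    ... | inj₂ refl | inj₂ refl = inj₁ ε
    ... | inj₂ refl | inj₁ v∈P  = let w′ , ⊆w = reverse (symmetric G) w in
      inj₁ (new-tree v∈P w′ λ z∈w z∈ → [ inj₂ , inj₁ ]′ (ends (⊆w z∈w) z∈))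

    addVertex-new : InTree addVertex x
    addVertex-new = inj₂ (refl , refl) ◅ grow t∈

    addVertex-old : ∀ {y} → InTree addVertex y → InTree P y ⊎ y ≡ x
    addVertex-old = old-or-new

    -- An old tree vertex attached to `y` is attached to `x` in the old tree, by prolonging its walk
    -- along the edge `yx`. So it lies below `t`, and thus below `x`.
    addVertex-dominates : ∀ {y} → edge G x y → Dominates addVertex y x
    addVertex-dominates {y} xy {z} (z∈ , w , only-z) with old-or-new z∈
    ... | inj₂ refl = ε
    ... | inj₁ z∈P  = inj₂ (refl , refl) ◅ grow (t-dominates (z∈P , w ◅◅ symmetric G xy ◅ ε , only))
      where
      only : ∀ {a} → a ∈ vertices (w ◅◅ symmetric G xy ◅ ε) → InTree P a → a ≡ z
      only a∈ a∈P with ∈-◅◅⁻ w a∈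
      ... | inj₁ a∈w                 = only-z a∈w (grow a∈P)
      ... | inj₂ (here refl)         = only-z (last∈ w) (grow a∈P)
      ... | inj₂ (there (here refl)) = contradiction a∈P x∉

  -- Finiteness provides a highest attached vertex, and positions in `members` later serve to count
  -- the limit.
  record Stage : Set (suc ℓ) where
    field
      parents : NormalParents G r
      members : List V
      finite  : ∀ {v} → InTree parents v → v ∈ members

  open Stage

  _≼_ : Stage → Stage → Set ℓ
  A ≼ B = ∀ {x p} → Parent (parents A) x p → Parent (parents B) x p

  -- Once `x` is added, it takes the part of `t` for the next vertex, by `addVertex-dominates`;
  -- uniqueness keeps the rest of the walk off the enlarged tree.
  addWalk : (A : Stage) {t x v : V} (w : Star (edge G) x v) → Unique (vertices w) →
            (∀ {y} → y ∈ vertices w → ¬ InTree (parents A) y) → InTree (parents A) t →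
            edge G x t → Dominates (parents A) x t →
            Σ[ B ∈ Stage ] (A ≼ B) × InTree (parents B) v
  addWalk A {t} {x} w un off t∈ xt dom = go w un off
    where
    new : (x∉ : ¬ InTree (parents A) x) → Stage
    new x∉ = record
      { parents = addVertex (parents A) x∉ t∈ xt dom
      ; members = x ∷ members A
      ; finite  = [ there ∘ finite A , here ]′ ∘ addVertex-old (parents A) x∉ t∈ xt dom }
    go : ∀ {v} (w : Star (edge G) x v) → Unique (vertices w) →
         (∀ {y} → y ∈ vertices w → ¬ InTree (parents A) y) →
         Σ[ B ∈ Stage ] (A ≼ B) × InTree (parents B) v
    go ε un off = let x∉ = off (here refl) in
      new x∉ , inj₁ , addVertex-new (parents A) x∉ t∈ xt dom
    go (e ◅ w) (x∉w ∷ un) off =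
      let x∉ = off (here refl)
          B , A≼B , v∈B = addWalk (new x∉) w un
            (λ y∈w → [ off (there y∈w) , (λ { refl → All¬⇒¬Any x∉w y∈w }) ]′
                       ∘ addVertex-old (parents A) x∉ t∈ xt dom)
            (addVertex-new (parents A) x∉ t∈ xt dom) (symmetric G e)
            (addVertex-dominates (parents A) x∉ t∈ xt dom e)
      in B , A≼B ∘ inj₁ , v∈B

  module _ (A : Stage) where
    private P = parents A

    -- Joined at `x`, the two witnessing walks meet the tree only in `y` and `z`, so normality
    -- applies.
    attached-comparable : ∀ {x y z} → ¬ InTree P x → Attached P x y → Attached P x z →
                          Star (Parent P) y z ⊎ Star (Parent P) z y
    attached-comparable {x} {y} {z} x∉ (y∈ , w , only-y) (z∈ , w′ , only-z) =
      let w⁻ , ⊆w′ = reverse (symmetric G) w′ in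
      normal P y∈ z∈ (w ◅◅ w⁻) λ a∈ a∈P →
        [ (λ a∈w → inj₁ (only-y a∈w a∈P)) , (λ a∈w → inj₂ (only-z (⊆w′ a∈w) a∈P)) ]′ (∈-◅◅⁻ w a∈)

    highest : ∀ {x t} → ¬ InTree P x → Attached P x t → ∀ L →
              ∃[ t′ ] Attached P x t′ × (∀ {z} → z ∈ L → Attached P x z → Star (Parent P) t′ z)
    highest x∉ att [] = _ , att , λ ()
    highest {x} x∉ att (z ∷ L) with highest x∉ att L | dec (Attached P x z)
    ... | t , att-t , hi | no ¬att-z = t , att-t , λ where
      (here refl) att-z → contradiction att-z ¬att-z
      (there z∈)        → hi z∈
    ... | t , att-t , hi | yes att-z with attached-comparable x∉ att-t att-z
    ...   | inj₁ tz = t , att-t , λ { (here refl) _ → tz ; (there y∈) → hi y∈ }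
    ...   | inj₂ zt = z , att-z , λ { (here refl) _ → ε ; (there y∈) att-y → zt ◅◅ hi y∈ att-y }

    last-exit : ∀ {u x} (w : Star (edge G) u x) →
                (∀ {y} → y ∈ vertices w → ¬ InTree P y) ⊎ ∃ (Attached P x)
    last-exit {u} ε with dec (InTree P u)
    ... | yes u∈ = inj₂ (u , u∈ , ε , λ { (here eq) _ → eq })
    ... | no  u∉ = inj₁ λ { (here refl) → u∉ }
    last-exit {u} (e ◅ w) with last-exit w | dec (InTree P u)
    ... | inj₂ att | _      = inj₂ att
    ... | inj₁ off | no  u∉ = inj₁ λ { (here refl) → u∉ ; (there y∈w) → off y∈w }
    ... | inj₁ off | yes u∈ = inj₂ (u , u∈ , e ◅ w , λ where
      (here eq)   _  → eq
      (there y∈w) y∈ → contradiction y∈ (off y∈w))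

    include : ∀ {v} → vertex G v → Σ[ B ∈ Stage ] (A ≼ B) × InTree (parents B) v
    include {v} v∈G with dec (InTree P v)
    ... | yes v∈ = A , id , v∈
    ... | no  v∉ with last-exit (walk (proj₂ connected r∈G v∈G))
    -- The walk starts at the root, which is in the tree.
    ...   | inj₁ off = contradiction ε (off (head∈ (walk (proj₂ connected r∈G v∈G))))
    ...   | inj₂ (_ , att) with highest v∉ att (members A)
    ...     | t , (t∈ , w , only-t) , hi with erase w
    ...       | ε , _ , _ = contradiction t∈ v∉
    ...       | e ◅ w′ , t∉ ∷ un , ⊆w = addWalk A w′ un off t∈ (symmetric G e) dominates
      where
      off : ∀ {y} → y ∈ vertices w′ → ¬ InTree P y
      off y∈w y∈ with refl ← only-t (⊆w (there y∈w)) y∈ = All¬⇒¬Any t∉ y∈w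
      -- Since `w′` runs off the tree, whatever is attached to its first vertex is attached to `v`,
      -- and `t` is highest among those.
      dominates : Dominates P _ t
      dominates (z∈ , wz , only-z) = hi (finite A z∈) (z∈ , wz ◅◅ w′ , λ a∈ a∈P →
        [ (λ a∈w → only-z a∈w a∈P) , (λ a∈w → contradiction a∈P (off a∈w)) ]′ (∈-◅◅⁻ wz a∈))

  -- The union of the stages

  module Limit (v : ℕ → V) (v∈G : ∀ n → vertex G (v n)) where

    stage : ℕ → Stage
    stage zero   = record { parents = trivial ; members = r ∷ []
                          ; finite = λ { ε → here refl ; (() ◅ _) } }
    stage (1+ n) = proj₁ (include (stage n) (v∈G n))

    private
      P : ℕ → NormalParents G r
      P n = parents (stage n)

    stage-mono : ∀ {m n} → m ≤ n → stage m ≼ stage n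
    stage-mono {m} m≤n with m≤n⇒∃[o]m+o≡n m≤n
    ... | k , refl = later k
      where
      later : ∀ k → stage m ≼ stage (m + k)
      later zero   rewrite +-identityʳ m = id
      later (1+ k) rewrite +-suc m k     =
        proj₁ (proj₂ (include (stage (m + k)) (v∈G (m + k)))) ∘ later k

    private
      Parent∞ : Rel V ℓ
      Parent∞ x p = ∃[ n ] Parent (P n) x p

      at-stage : ∀ {u v} → Star Parent∞ u v → ∃[ n ] Star (Parent (P n)) u v
      at-stage ε = 0 , ε
      at-stage ((m , e) ◅ w) with at-stage w
      ... | n , w′ = m ⊔ n , stage-mono (m≤m⊔n m n) e ◅ Star.map (stage-mono (m≤n⊔m m n)) w′

      in-limit : ∀ n {u v} → Star (Parent (P n)) u v → Star Parent∞ u v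
      in-limit n = Star.map (n ,_)

    -- Finitely many parent steps occur together at one stage. For normality, a walk that meets the
    -- limit only in its ends also meets that stage only there.
    limit : NormalParents G r
    Parent        limit = Parent∞
    deterministic limit (m , e) (n , f) = deterministic (P (m ⊔ n))
      (stage-mono (m≤m⊔n m n) e) (stage-mono (m≤n⊔m m n) f)
    rootless      limit (n , e) = rootless (P n) e
    parent-edge   limit (n , e) = parent-edge (P n) e
    rooted        limit (n , e) = in-limit n (rooted (P n) e)
    normal        limit u∈ v∈ w ends with at-stage u∈ | at-stage v∈
    ... | m , u∈m | n , v∈n =
      [ inj₁ ∘ in-limit (m ⊔ n) , inj₂ ∘ in-limit (m ⊔ n) ]′
        (normal (P (m ⊔ n)) (Star.map (stage-mono (m≤m⊔n m n)) u∈m)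
          (Star.map (stage-mono (m≤n⊔m m n)) v∈n) w λ z∈w → ends z∈w ∘ in-limit (m ⊔ n))

    v∈limit : ∀ n → InTree limit (v n)
    v∈limit n = in-limit (1+ n) (proj₂ (proj₂ (include (stage n) (v∈G n))))

    limit-countable : Countable (setoid V) (InTree limit)
    limit-countable = countable (setoid V) Code (λ n x → dec (Code n x)) coded
      (λ { refl → id }) unique
      where
      Code : ℕ → Pred V ℓ
      Code k x = ∃[ n ] Σ[ x∈ ∈ x ∈ members (stage n) ] k ≡ code (n ∷ toℕ (index x∈) ∷ [])
      coded : ∀ {x} → InTree limit x → ∃[ k ] Code k x
      coded x∈ = let n , x∈n = at-stage x∈ in _ , n , finite (stage n) x∈n , refl
      unique : ∀ {k x y} → Code k x → Code k y → x ≡ y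
      unique (n , x∈ , eq) (n′ , y∈ , eq′) =
        same {n} {n′} x∈ y∈ (code-injective (trans (sym eq) eq′))
        where
        same : ∀ {n n′ x y} (x∈ : x ∈ members (stage n)) (y∈ : y ∈ members (stage n′)) →
               n ∷ toℕ (index x∈) ∷ [] ≡ n′ ∷ toℕ (index y∈) ∷ [] → x ≡ y
        same {n} x∈ y∈ eq with refl ← ∷-injectiveˡ eq =
          trans (lookup-index x∈) (trans (cong (lookup (members (stage n)))
            (Fin-toℕ-injective (∷-injectiveˡ (∷-injectiveʳ eq)))) (sym (lookup-index y∈)))

-- The implications between the properties of the end space

module EndSpace {ℓ} (em : ExcludedMiddle (suc ℓ)) {V : Set ℓ} (G : Graph V)
                (connected : Connected G) where

  open Classical em {V}
  open NormalTrees em {V}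

  -- One ray is chosen from each nonempty member of the base, indexed by its number.
  secondCountable⇒separable : SecondCountable G → Separable G
  secondCountable⇒separable (𝓑 , 𝓑-countable , _ , refine) =
    (λ R → ∃[ n ] Chosen n R) , D-countable , dense
    where
    open Injection 𝓑-countable renaming (to to number; injective to number-injective)

    Choice : ℕ → Set (suc ℓ)
    Choice n = Σ[ (B , B∈) ∈ ∃ 𝓑 ] number (B , B∈) ≡ n × ∃ B

    -- `Choice n` lives one universe too high for a set of rays; matching on its decision brings the
    -- predicate down to level ℓ.
    isChosen : ∀ {n} → Dec (Choice n) → Pred (Ray G) ℓ
    isChosen (yes (_ , _ , R , _)) S = R ≡ S
    isChosen (no _)                S = Lift ℓ ⊥

    Chosen : ℕ → Pred (Ray G) ℓ
    Chosen n = isChosen (em {P = Choice n})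

    Chosen-unique : ∀ n {R S} → Chosen n R → Chosen n S → R ≡ S
    Chosen-unique n with em {P = Choice n}
    ... | yes _ = λ { refl refl → refl }

    Code : ℕ → Pred (Ray G) ℓ
    Code n S = ∃[ R ] Chosen n R × Equivalent G R S

    D-countable : Countable (Ends G) (λ R → ∃[ n ] Chosen n R)
    D-countable = countable (Ends G) Code (λ n S → dec (Code n S))
      (λ {R} (n , c) → n , R , c , Equivalent-refl G {R})
      (λ { {_} {S} {S′} S~S′ (R , c , R~S) → R , c , Equivalent-trans G {R} {S} {S′} R~S S~S′ })
      (λ { {n} {S} {S′} (R , c , R~S) (R′ , c′ , R′~S′) →
           Equivalent-trans G {S} {R} {S′} (Equivalent-sym G {R} {S} R~S)
             (subst (λ Q → Equivalent G Q S′) (Chosen-unique n c′ c) R′~S′) })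

    dense : IsDense G (λ R → ∃[ n ] Chosen n R)
    dense U-open (R , R∈U) with refine U-open R∈U
    ... | B , B∈ , R∈B , B⊆U = chosen-in-U
      where
      n = number (B , B∈)
      chosen-in-U : ∃[ S ] (∃[ n ] Chosen n S) × _
      chosen-in-U = let S , c , S∈B = chosen-in-B in S , (n , c) , B⊆U S∈B
        where
        chosen-in-B : ∃[ S ] Chosen n S × B S
        chosen-in-B with em {P = Choice n}
        -- The ray was chosen from some set with the number of `B`; by injectivity that set has the
        -- same elements as `B`.
        ... | yes (_ , eq , S , S∈) = S , refl , proj₁ (number-injective eq) S∈
        ... | no  ∄                 = contradiction ((B , B∈) , refl , R , R∈B) ∄

  separable⇒normalTree : Separable G → CountableEndFaithfulNormalTree G
  separable⇒normalTree (D , D-countable , dense) =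
    parentTree , r , isNormalTree , limit-countable ,
    (λ {R} {S} → ι-injective {R} {S}) , ι-surjective
    where
    open Injection D-countable renaming (to to number; injective to number-injective)
    r   = proj₁ (proj₁ connected)
    r∈G = proj₂ (proj₁ connected)

    Member : ℕ → Set ℓ
    Member n = Σ[ d ∈ ∃ D ] number d ≡ n

    member : ∀ n → Dec (Member n)
    member n = dec (Member n)

    -- Equivalent rays of `D` share their number, so `member` fixes one ray for each number; `m` is
    -- a position on it.
    CodedVertex : ℕ → Pred V ℓ
    CodedVertex k v = ∃₂ λ R m → Σ[ (n , d) ∈ (∃[ n ] Member n) ]
      member n ≡ yes d × proj₁ (proj₁ d) ≡ R × k ≡ code (n ∷ m ∷ []) × at R m ≡ v

    target : ∀ {k} → Dec (∃ (CodedVertex k)) → V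
    target (yes (v , _)) = v
    -- Numbers that code no vertex contribute the root, which is in the tree from the start.
    target (no _)        = r

    target∈G : ∀ {k} (d : Dec (∃ (CodedVertex k))) → vertex G (target d)
    target∈G (yes (_ , R , m , _ , _ , _ , _ , refl)) = endvertex G (adjacent R m)
    target∈G (no _)                                   = r∈G

    open Jung em connected r∈G
    open Limit (λ k → target {k} (dec _)) (λ k → target∈G {k} (dec _))
    open ParentTrees em r∈G limit
    open NormalParents limit using (InTree)
    open Normal isNormalTree using (ι-injective)

    member-in-tree : ∀ n (d : Member n) → member n ≡ yes d → ∀ m → InTree (at (proj₁ (proj₁ d)) m)
    member-in-tree n d eq m = subst InTree (hits (dec _)) (v∈limit k)
      where
      k = code (n ∷ m ∷ [])
      hits : (c : Dec (∃ (CodedVertex k))) → target c ≡ at (proj₁ (proj₁ d)) m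
      hits (no ∄) = contradiction (_ , _ , m , (n , d) , eq , refl , refl , refl) ∄
      hits (yes (_ , R , m′ , (n′ , d′) , eq′ , refl , k≡ , refl)) =
        same (code-injective k≡) eq′
        where
        same : ∀ {n′ m′} {d′ : Member n′} → n ∷ m ∷ [] ≡ n′ ∷ m′ ∷ [] → member n′ ≡ yes d′ →
               at (proj₁ (proj₁ d′)) m′ ≡ at (proj₁ (proj₁ d)) m
        same refl eq′ with refl ← trans (sym eq) eq′ = refl

    -- Density yields a ray of `D` in Ω(Z,C), where `C` contains a tail of `R`. The ray `Q` fixed
    -- for its number is equivalent to it, so `Q` also has a tail in `C`, and `Q` lies in the tree.
    meets : ∀ R Z → ∃[ s ] InTree s × Near R Z s
    meets R Z with avoids R Z
    ... | n , av with dense (basic⇒open {G} (Z , C , isC , id , id))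
                            (R , Ω-intro isC {R} {n} av ε)
      where
      C   = component (G − Z) (at R n)
      isC : IsComponent (G − Z) C
      isC = component-isComponent {G − Z}
        (endvertex G (adjacent R n) , subst (λ k → at R k ∉ Z) (+-identityʳ n) (av 0))
    ...   | S , S∈D , S∈Ω with member (number (S , S∈D)) in eq
    ...     | no ∄ = contradiction ((S , S∈D) , refl) ∄
    ...     | yes d@((Q , Q∈D) , same) =
      let m , tail = S∈Ω Q (number-injective same)
      in at Q (m + 0) , member-in-tree _ d eq (m + 0) , n ,
         λ i → av i , rev {G = G − Z} (along R av i) ◅◅ tail 0

    ι-surjective : ∀ R → ∃[ S ] (∀ {Q} → Equivalent parentTree Q S →
                     Equivalent G (ray-⊑ parentTree⊑G Q) R)
    ι-surjective R = climb , λ {Q} Q~S →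
      Equivalent-trans G {ray-⊑ parentTree⊑G Q} {ray-⊑ parentTree⊑G climb} {R}
        (Func.cong (ι parentTree⊑G) {Q} {climb} Q~S) climb~R
      where
      open Climb R (meets R)

  normalTree⇒basicBase : CountableEndFaithfulNormalTree G → CountableBasicBase G
  normalTree⇒basicBase (T , r , N , T-countable , _ , ι-surjective) =
    (λ U → ∃[ k ] Code k U) ,
    (𝓑-countable , (basic⇒open ∘ 𝓑-basic) , refine) , 𝓑-basic
    where
    open Injection T-countable renaming (to to number; injective to number-injective)
    open IsNormalTree N using (subgraph)
    open Normal N using (closure; closure⊆T; inside; on-tree; avoids-closure⇒avoids)

    -- The head `s` of the coded list names the component through one of its tree vertices; the rest
    -- `Y` is the deleted set.
    Code : ℕ → Pred (Pred (Ray G) ℓ) (suc ℓ)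
    Code k U = ∃₂ λ s Y → ∃[ C ] k ≡ code (map number (s ∷ Y))
      × IsComponent (G − map proj₁ Y) C × vertex C (proj₁ s) × U ≐ Ω G (map proj₁ Y) C

    Code-unique : ∀ {k U W} → Code k U → Code k W → U ≐ W
    Code-unique (s , Y , C , eq , isC , s∈C , U≐) (s′ , Y′ , C′ , eq′ , isC′ , s′∈C′ , W≐) =
      same (map-reflects number-injective (s ∷ Y) (s′ ∷ Y′) (code-injective (trans (sym eq) eq′)))
           isC s∈C U≐ isC′ s′∈C′ W≐
      where
      same : ∀ {x x′ X X′ C C′} {U W : Pred (Ray G) ℓ} → x ∷ X ≡ x′ ∷ X′ →
             IsComponent (G − X) C → vertex C x → U ≐ Ω G X C →
             IsComponent (G − X′) C′ → vertex C′ x′ → W ≐ Ω G X′ C′ → U ≐ W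
      same {X = X} {C = C} {C′ = C′} refl isC x∈C (U⊆ , ⊆U) isC′ x∈C′ (W⊆ , ⊆W) =
        (λ {R} R∈ → ⊆W (Ω-same {G} {X} {C} {C′} isC isC′ x∈C x∈C′ {R} (U⊆ R∈))) ,
        (λ {R} R∈ → ⊆U (Ω-same {G} {X} {C′} {C} isC′ isC x∈C′ x∈C {R} (W⊆ R∈)))

    𝓑-countable : Countable (≐-setoid (Ray G) ℓ) (λ U → ∃[ k ] Code k U)
    𝓑-countable = countable (≐-setoid (Ray G) ℓ) Code (λ _ _ → em) id
      (λ { (U⊆W , W⊆U) (s , Y , C , eq , isC , s∈ , U⊆ , ⊆U) →
           s , Y , C , eq , isC , s∈ , U⊆ ∘ W⊆U , U⊆W ∘ ⊆U })
      Code-unique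

    𝓑-basic : ∀ {U} → ∃[ k ] Code k U → IsBasicOpen G U
    𝓑-basic (_ , _ , Y , C , _ , isC , _ , U≐) = map proj₁ Y , C , isC , U≐

    onTree : ∀ R → ∃[ S ] Equivalent G (ray-⊑ subgraph S) R
    onTree R = let S , f = ι-surjective R in S , f {S} (Equivalent-refl T {S})

    refine : ∀ {U R} → IsOpen G U → U R → ∃[ B ] (∃[ k ] Code k B) × B R × B ⊆ U
    refine {U} {R} U-open R∈U with U-open R∈U
    ... | B₀ , (X , C₀ , isC₀ , B₀⊆ , ⊆B₀) , R∈B₀ , B₀⊆U
      with attach-proofs (closure X) (closure⊆T X) | onTree R
    ...   | Y , eq | S , S~R with avoids S (closure X)
    ...     | n , avS =
      Ω G (closure X) C ,
      (_ , (s , on-tree S n) , Y , C , refl ,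
        subst (λ Z → IsComponent (G − Z) C × vertex C s × Ω G (closure X) C ≐ Ω G Z C) (sym eq)
          (isC , ε , id , id)) ,
      Ω-resp {G} {C} {closure X} {S′} {R} S~R (Ω-intro isC {S′} {n} avS ε) ,
      λ {Q} Q∈ → B₀⊆U (⊆B₀ (inclusion Q Q∈))
      where
      S′  = ray-⊑ subgraph S
      s   = at S n
      s∉  : s ∉ closure X
      s∉  = subst (λ k → at S k ∉ closure X) (+-identityʳ n) (avS 0)
      C   = component (G − closure X) s
      isC : IsComponent (G − closure X) C
      isC = component-isComponent {G − closure X} (endvertex G (adjacent S′ n) , s∉)
      -- Some tail of `S` lies in `C₀`, and from `s` on `S` avoids `X`.
      s∈C₀ : vertex C₀ s
      s∈C₀ with Ω-tail {G} {C₀} {X} {S′} (Ω-resp {G} {C₀} {X} {R} {S′}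
                 (Equivalent-sym G {S′} {R} S~R) (B₀⊆ R∈B₀))
      ... | m , tail = component-closed isC₀
              (subst (λ k → vertex C₀ (at S k)) (+-comm m n) (tail n))
              (rev {G = G − X} (along S′ (avoids-closure⇒avoids S avS) m))
      -- Replace `Q` by an equivalent ray `P` of `T`. A tail of `P` is joined to `s` in
      -- `G − closure X`, hence by `inside` in `T − X`, and so it lies in `C₀` with `s`.
      inclusion : ∀ Q → Ω G (closure X) C Q → Ω G X C₀ Q
      inclusion Q Q∈ with onTree Q
      ... | P , P~Q with Ω-tail {G} {C} {closure X} {ray-⊑ subgraph P}
              (Ω-resp {G} {C} {closure X} {Q} {ray-⊑ subgraph P}
                (Equivalent-sym G {ray-⊑ subgraph P} {Q} P~Q) Q∈)
      ...   | m , tail = Ω-resp {G} {C₀} {X} {P′} {Q} P~Q (Ω-intro isC₀ {P′} {m} avP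
                (component-closed isC₀ s∈C₀ (walk-on subgraph X
                  (inside (on-tree S n) (on-tree P m) s∉ at-m))))
        where
        P′  = ray-⊑ subgraph P
        at-m : Star (edge (G − closure X)) s (at P m)
        at-m = subst (λ k → Star (edge (G − closure X)) s (at P k)) (+-identityʳ m) (tail 0)
        avP : Avoids P′ m X
        avP = avoids-closure⇒avoids P λ i → stays-off {G = G} s∉ (tail i)

theorem4p2 : ∀ {ℓ} → ExcludedMiddle (suc ℓ) →
    {V : Set ℓ} (G : Graph V) → Connected G →
    (SecondCountable G ⇔ Separable G)
    × (Separable G ⇔ CountableEndFaithfulNormalTree G)
    × (CountableEndFaithfulNormalTree G ⇔ CountableBasicBase G)
theorem4p2 em G connected =
    mk⇔ i⇒ii (iv⇒i ∘ iii⇒iv ∘ ii⇒iii)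
  , mk⇔ ii⇒iii (i⇒ii ∘ iv⇒i ∘ iii⇒iv)
  , mk⇔ iii⇒iv (ii⇒iii ∘ i⇒ii ∘ iv⇒i)
  where
  open EndSpace em G connected renaming
    ( secondCountable⇒separable to i⇒ii
    ; separable⇒normalTree      to ii⇒iii
    ; normalTree⇒basicBase      to iii⇒iv )
  iv⇒i : CountableBasicBase G → SecondCountable G
  iv⇒i (𝓑 , 𝓑-base , _) = 𝓑 , 𝓑-base
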